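{- If $G$ is a strongly regular graph with parameters $(99,14,1,2)$, then $G$ does not follow the Paley(9) pattern.
   Context: All graphs are finite, simple and connected. A graph $G=(V,E)$ is strongly regular with parameters $(n,k,\lambda,\mu)$ if it has $n$ vertices, is $k$-regular, is neither complete nor empty, every two adjacent vertices have exactly $\lambda$ common neighbours, and every two distinct non-adjacent vertices have exactly $\mu$ common neighbours. $N(v)$ denotes the set of neighbours of $v$, and $E(N(v))$ the set of edges of $G$ with both endpoints in $N(v)$. The Paley(9) graph is the graph with vertex set the field $GF(9)$ in which two distinct vertices are adjacent iff their difference is a non-zero square in $GF(9)$; it is strongly regular with parameters $(9,4,1,2)$. Let $G$ be strongly regular with parameters $(n,k,1,2)$. For a vertex $v$, the condition $\lambda=1$ implies that $E(N(v))$ is a perfect matching of $N(v)$. For two non-adjacent vertices $a,b\in N(v)$, let $(a,b)_v$ denote the unique common neighbour of $a$ and $b$ other than $v$ (it is a non-neighbour of $v$). The graph $G$ follows the Paley(9) pattern if for every vertex $v\in V$ and every two distinct edges $\{v_1,v_2\},\{v_3,v_4\}\in E(N(v))$, the subgraph of $G$ induced by $$P_v=\{v,v_1,v_2,v_3,v_4,(v_1,v_3)_v,(v_1,v_4)_v,(v_2,v_3)_v,(v_2,v_4)_v\}$$ is (isomorphic to) the Paley(9) graph. -}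

module Defs where

open import Algebra.Structures using (IsCommutativeRing)
open import Data.Fin using (Fin; toℕ)
open import Data.Fin.Patterns using (0F; 1F)
import Data.Fin.Properties as Fin
open import Data.Fin.Subset using (Subset; _∈_; _∩_; _∪_; ∣_∣; ⁅_⁆)
open import Data.Nat using (ℕ; _+_; _*_; _∸_)
open import Data.Nat.DivMod using (_mod_)
open import Data.Product using (Σ; ∃; _×_; _,_; proj₁)
open import Data.Product.Properties using (≡-dec)
open import Data.Vec using (tabulate)
open import Function.Base using (_on_)
open import Function.Bundles using (_↔_; _⇔_; Inverse)
open import Level using (0ℓ)
open import Relation.Binary.Core using (Rel)
open import Relation.Binary.Construct.Closure.ReflexiveTransitive using (Star)
open import Relation.Binary.Definitions using (Decidable; DecidableEquality; Irreflexive; Symmetric)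
open import Relation.Binary.PropositionalEquality
  using (_≡_; _≢_; refl; cong; cong₂; isEquivalence)
open import Relation.Nullary using (¬_)
open import Relation.Nullary.Decidable
  using (Dec; does; from-yes; map′; ¬?; _×-dec_; _→-dec_)
import Relation.Unary as Unary

record Graph (V : Set) : Set₁ where
  field
    Adj    : Rel V 0ℓ
    sym    : Symmetric Adj
    irrefl : Irreflexive _≡_ Adj
    adj?   : Decidable Adj

open Graph

Connected : {V : Set} → Graph V → Set
Connected G = ∀ u v → Star (Adj G) u v

induced : {n : ℕ} → Graph (Fin n) → (S : Subset n) → Graph (∃ λ v → v ∈ S)
induced G S = record
  { Adj    = Adj G on proj₁
  ; sym    = sym G
  ; irrefl = λ { refl → irrefl G refl }
  ; adj?   = λ u v → adj? G (proj₁ u) (proj₁ v)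
  }

infix 4 _≅_

_≅_ : {V W : Set} → Graph V → Graph W → Set
_≅_ {V} {W} G H =
  Σ (V ↔ W) λ f → ∀ u v → Adj G u v ⇔ Adj H (Inverse.to f u) (Inverse.to f v)

N : {n : ℕ} → Graph (Fin n) → Fin n → Subset n
N G v = tabulate λ w → does (adj? G v w)

record StronglyRegular (n k l m : ℕ) (G : Graph (Fin n)) : Set where
  field
    regular     : ∀ v → ∣ N G v ∣ ≡ k
    notComplete : ¬ (∀ u v → u ≢ v → Adj G u v)
    notEmpty    : ¬ (∀ u v → ¬ Adj G u v)
    adjacent    : ∀ u v → Adj G u v → ∣ N G u ∩ N G v ∣ ≡ l
    nonadjacent : ∀ u v → u ≢ v → ¬ Adj G u v → ∣ N G u ∩ N G v ∣ ≡ m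

-- (a , b) stands for a + b·i in 𝔽₃[i] with i² = -1.
GF9 : Set
GF9 = Fin 3 × Fin 3

module 𝔽₃ where

  infixl 6 _⊕_
  infixl 7 _⊗_

  _⊕_ _⊗_ : Fin 3 → Fin 3 → Fin 3
  x ⊕ y = (toℕ x + toℕ y) mod 3
  x ⊗ y = (toℕ x * toℕ y) mod 3

  ⊖_ : Fin 3 → Fin 3
  ⊖ x = (3 ∸ toℕ x) mod 3

module GF9 where

  open 𝔽₃

  infixl 6 _+ᶠ_ _-ᶠ_
  infixl 7 _*ᶠ_

  _+ᶠ_ _*ᶠ_ : GF9 → GF9 → GF9
  (a , b) +ᶠ (c , d) = a ⊕ c , b ⊕ d
  (a , b) *ᶠ (c , d) = (a ⊗ c) ⊕ (⊖ (b ⊗ d)) , (a ⊗ d) ⊕ (b ⊗ c)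

  negᶠ : GF9 → GF9
  negᶠ (a , b) = ⊖ a , ⊖ b

  _-ᶠ_ : GF9 → GF9 → GF9
  x -ᶠ y = x +ᶠ negᶠ y

  0ᶠ 1ᶠ : GF9
  0ᶠ = 0F , 0F
  1ᶠ = 1F , 0F

  NonzeroSquare : GF9 → Set
  NonzeroSquare x = x ≢ 0ᶠ × ∃ λ y → x ≡ y *ᶠ y

  _≟_ : DecidableEquality GF9
  _≟_ = ≡-dec Fin._≟_ Fin._≟_

  all? : {P : GF9 → Set} → Unary.Decidable P → Dec (∀ x → P x)
  all? P? = map′ (λ p (a , b) → p a b) (λ p a b → p (a , b))
    (Fin.all? λ a → Fin.all? λ b → P? (a , b))

  any? : {P : GF9 → Set} → Unary.Decidable P → Dec (∃ P)
  any? P? = map′ (λ (a , b , p) → (a , b) , p) (λ ((a , b) , p) → a , b , p)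
    (Fin.any? λ a → Fin.any? λ b → P? (a , b))

  nonzeroSquare? : Unary.Decidable NonzeroSquare
  nonzeroSquare? x = ¬? (x ≟ 0ᶠ) ×-dec any? λ y → x ≟ (y *ᶠ y)

  isCommutativeRing : IsCommutativeRing _≡_ _+ᶠ_ _*ᶠ_ negᶠ 0ᶠ 1ᶠ
  isCommutativeRing = record
    { isRing = record
      { +-isAbelianGroup = record
        { isGroup = record
          { isMonoid = record
            { isSemigroup = record
              { isMagma = record
                { isEquivalence = isEquivalence
                ; ∙-cong = cong₂ _+ᶠ_
                }
              ; assoc = from-yes (all? λ x → all? λ y → all? λ z →
                  ((x +ᶠ y) +ᶠ z) ≟ (x +ᶠ (y +ᶠ z)))
              }
            ; identity = from-yes (all? λ x → (0ᶠ +ᶠ x) ≟ x)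
                       , from-yes (all? λ x → (x +ᶠ 0ᶠ) ≟ x)
            }
          ; inverse = from-yes (all? λ x → (negᶠ x +ᶠ x) ≟ 0ᶠ)
                    , from-yes (all? λ x → (x +ᶠ negᶠ x) ≟ 0ᶠ)
          ; ⁻¹-cong = cong negᶠ
          }
        ; comm = from-yes (all? λ x → all? λ y → (x +ᶠ y) ≟ (y +ᶠ x))
        }
      ; *-cong = cong₂ _*ᶠ_
      ; *-assoc = from-yes (all? λ x → all? λ y → all? λ z →
          ((x *ᶠ y) *ᶠ z) ≟ (x *ᶠ (y *ᶠ z)))
      ; *-identity = from-yes (all? λ x → (1ᶠ *ᶠ x) ≟ x)
                   , from-yes (all? λ x → (x *ᶠ 1ᶠ) ≟ x)
      ; distrib = from-yes (all? λ x → all? λ y → all? λ z →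
                    (x *ᶠ (y +ᶠ z)) ≟ ((x *ᶠ y) +ᶠ (x *ᶠ z)))
                , from-yes (all? λ x → all? λ y → all? λ z →
                    ((y +ᶠ z) *ᶠ x) ≟ ((y *ᶠ x) +ᶠ (z *ᶠ x)))
      }
    ; *-comm = from-yes (all? λ x → all? λ y → (x *ᶠ y) ≟ (y *ᶠ x))
    }

  invertible : ∀ x → x ≢ 0ᶠ → ∃ λ y → (x *ᶠ y) ≡ 1ᶠ
  invertible = from-yes (all? λ x → ¬? (x ≟ 0ᶠ) →-dec any? λ y → (x *ᶠ y) ≟ 1ᶠ)

paley9 : Graph GF9
paley9 = record
  { Adj    = λ x y → x ≢ y × NonzeroSquare (x -ᶠ y)
  ; sym    = λ {x} {y} → paley-sym x y
  ; irrefl = λ x≡y (x≢y , _) → x≢y x≡y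
  ; adj?   = paley-adj?
  }
  where
  open GF9

  paley-adj? : Decidable λ x y → x ≢ y × NonzeroSquare (x -ᶠ y)
  paley-adj? x y = ¬? (x ≟ y) ×-dec nonzeroSquare? (x -ᶠ y)

  paley-sym : ∀ x y → x ≢ y × NonzeroSquare (x -ᶠ y) → y ≢ x × NonzeroSquare (y -ᶠ x)
  paley-sym = from-yes (all? λ x → all? λ y → paley-adj? x y →-dec paley-adj? y x)

module _ {n : ℕ} (G : Graph (Fin n)) where

  -- x = (a,b)ᵥ.  In a graph with μ = 2 there is exactly one such x whenever
  -- a and b are distinct non-adjacent neighbours of v.
  record IsOtherCommonNeighbour (v a b x : Fin n) : Set where
    field
      common : x ∈ N G a ∩ N G b
      other  : x ≢ v
      unique : ∀ y → y ∈ N G a ∩ N G b → y ≢ v → y ≡ x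

  -- {a , b} ∈ E(N(v))
  IsNeighbourhoodEdge : Fin n → Fin n → Fin n → Set
  IsNeighbourhoodEdge v a b = a ∈ N G v × b ∈ N G v × Adj G a b

  FollowsPaley9Pattern : Set
  FollowsPaley9Pattern =
    ∀ v v₁ v₂ v₃ v₄ →
    IsNeighbourhoodEdge v v₁ v₂ →
    IsNeighbourhoodEdge v v₃ v₄ →
    ⁅ v₁ ⁆ ∪ ⁅ v₂ ⁆ ≢ ⁅ v₃ ⁆ ∪ ⁅ v₄ ⁆ →
    ∀ x₁₃ x₁₄ x₂₃ x₂₄ →
    IsOtherCommonNeighbour v v₁ v₃ x₁₃ →
    IsOtherCommonNeighbour v v₁ v₄ x₁₄ →
    IsOtherCommonNeighbour v v₂ v₃ x₂₃ →
    IsOtherCommonNeighbour v v₂ v₄ x₂₄ →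
    induced G
      (⁅ v ⁆ ∪ ⁅ v₁ ⁆ ∪ ⁅ v₂ ⁆ ∪ ⁅ v₃ ⁆ ∪ ⁅ v₄ ⁆ ∪
       ⁅ x₁₃ ⁆ ∪ ⁅ x₁₄ ⁆ ∪ ⁅ x₂₃ ⁆ ∪ ⁅ x₂₄ ⁆)
    ≅ paley9

{-# OPTIONS --safe #-}
module Submission where

-- Any two triangles through a vertex span a 3 × 3 grid.  A vertex off a grid has
-- at most one neighbour in it because λ = 1 and μ = 2, and exactly one because
-- k = 14 < 18.  Hence if two disjoint grids are matched along a row and a column,
-- sending a vertex to its neighbour in the other grid is a grid isomorphism, and
-- so seven suitably adjacent vertices of a cube complete to the whole cube.
--
-- Now let v and s be opposite in a grid, and link two neighbours of v off the
-- grid when they have a common neighbour adjacent to s.  Each of them has two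
-- links, and by cube completion its two linked vertices are linked to each other.
-- So the 14 - 4 = 10 neighbours of v off the grid fall into classes of size
-- three, which is impossible.

open import Defs
open import Data.Bool using (Bool; true; false)
open import Data.Fin using (Fin; suc)
open import Data.Fin.Patterns using (0F; 1F; 2F)
import Data.Fin.Properties as Fin
open import Data.Fin.Subset
  using (Subset; inside; outside; _∈_; _∩_; _∪_; ∣_∣; ⁅_⁆)
  renaming (⊥ to ∅)
import Data.Fin.Subset.Properties as Subset
open import Data.List using (List; []; _∷_; length; foldr; allFin; cartesianProduct)
import Data.List.Membership.Propositional as List
import Data.List.Membership.DecPropositional as DecMembership
open import Data.List.Relation.Unary.All as All using (All; []; _∷_)
import Data.List.Relation.Unary.All.Properties as All
open import Data.List.Relation.Unary.AllPairs using ([]; _∷_)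
open import Data.List.Relation.Unary.Any using (here; there)
open import Data.List.Relation.Unary.Unique.Propositional using (Unique)
import Data.List.Relation.Unary.Unique.Propositional.Properties as Unique
open import Data.Nat using (ℕ; suc; _+_; _*_; _≤_; _<_; z≤n; s≤s)
import Data.Nat.Properties as ℕ
open import Data.Product using (∃; _×_; _,_; proj₁; proj₂)
open import Data.Sum using (_⊎_; inj₁; inj₂)
open import Data.Vec using ([]; _∷_)
open import Data.Vec.Properties using (lookup∘tabulate; []=⇒lookup; lookup⇒[]=)
open import Function using (Equivalence; Inverse; Injection)
open import Function.Properties.Inverse using (↔⇒↣)
open import Relation.Binary.PropositionalEquality
  using (_≡_; _≢_; refl; sym; trans; cong; subst; ≢-sym)
open import Relation.Nullary using (¬_; yes; no; contradiction)
open import Relation.Nullary.Decidable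
  using (from-yes; ¬?; _×-dec_; _→-dec_; dec-true; decidable-stable; does)

-- Finite checks: the Paley(9) graph and pairs of indices below 3.

opaque

  -- Decided by enumeration over GF(9). In the notation of the pattern, `c` is (a,b)_v and `d` is
  -- (a′,b)_v. All that the proof takes from Paley(9) is this adjacency.
  paley9-square : let open Graph paley9 in
    ∀ v a → Adj v a → ∀ a′ → Adj v a′ → Adj a a′ →
    ∀ b → Adj v b → a ≢ b → ¬ Adj a b →
    ∀ c → Adj a c → Adj b c → c ≢ v →
    ∀ d → Adj a′ d → Adj b d → d ≢ v → Adj c d
  paley9-square = from-yes (all? λ v → all? λ a → adj? v a →-dec all? λ a′ →
    adj? v a′ →-dec adj? a a′ →-dec all? λ b → adj? v b →-dec ¬? (a ≟ b) →-dec
    ¬? (adj? a b) →-dec all? λ c → adj? a c →-dec adj? b c →-dec ¬? (c ≟ v) →-dec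
    all? λ d → adj? a′ d →-dec adj? b d →-dec ¬? (d ≟ v) →-dec adj? c d)
    where
    open Graph paley9 using (adj?)
    open GF9 using (all?; _≟_)

thirdIndex : ∀ (i i′ : Fin 3) → ∃ λ i″ → i″ ≢ i × i″ ≢ i′
thirdIndex 0F 0F = 1F , (λ ()) , λ ()
thirdIndex 0F 1F = 2F , (λ ()) , λ ()
thirdIndex 0F 2F = 1F , (λ ()) , λ ()
thirdIndex 1F 0F = 2F , (λ ()) , λ ()
thirdIndex 1F 1F = 0F , (λ ()) , λ ()
thirdIndex 1F 2F = 0F , (λ ()) , λ ()
thirdIndex 2F 0F = 1F , (λ ()) , λ ()
thirdIndex 2F 1F = 0F , (λ ()) , λ ()
thirdIndex 2F 2F = 0F , (λ ()) , λ ()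

-- Alternating the two rules from 01 visits all six pairs: 01, 21, 20, 10, 12, 02.
offDiagonal : (P : Fin 3 → Fin 3 → Set) →
  (∀ {i i′ i″} → i ≢ i′ → i″ ≢ i → i″ ≢ i′ → P i i′ → P i″ i′) →
  (∀ {i i′ i″} → i ≢ i′ → i″ ≢ i → i″ ≢ i′ → P i i′ → P i i″) →
  P 0F 1F → ∀ {i i′} → i ≢ i′ → P i i′
offDiagonal P left right p₀₁ {i} {i′} = go i i′
  where
  p₂₁ : P 2F 1F
  p₂₁ = left (λ ()) (λ ()) (λ ()) p₀₁
  p₂₀ : P 2F 0F
  p₂₀ = right (λ ()) (λ ()) (λ ()) p₂₁
  p₁₀ : P 1F 0F
  p₁₀ = left (λ ()) (λ ()) (λ ()) p₂₀
  p₁₂ : P 1F 2F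
  p₁₂ = right (λ ()) (λ ()) (λ ()) p₁₀
  p₀₂ : P 0F 2F
  p₀₂ = left (λ ()) (λ ()) (λ ()) p₁₂
  go : ∀ i i′ → i ≢ i′ → P i i′
  go 0F 0F 0≢0 = contradiction refl 0≢0
  go 0F 1F _ = p₀₁
  go 0F 2F _ = p₀₂
  go 1F 0F _ = p₁₀
  go 1F 1F 1≢1 = contradiction refl 1≢1
  go 1F 2F _ = p₁₂
  go 2F 0F _ = p₂₀
  go 2F 1F _ = p₂₁
  go 2F 2F 2≢2 = contradiction refl 2≢2

triangle : ∀ {A : Set} {R : A → A → Set} → (∀ {x y} → R x y → R y x) →
  (f : Fin 3 → A) → R (f 0F) (f 1F) → R (f 0F) (f 2F) → R (f 1F) (f 2F) →
  ∀ {i i′} → i ≢ i′ → R (f i) (f i′)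
triangle {R = R} R-sym f r₀₁ r₀₂ r₁₂ {i} {i′} = go i i′
  where
  go : ∀ i i′ → i ≢ i′ → R (f i) (f i′)
  go 0F 0F 0≢0 = contradiction refl 0≢0
  go 0F 1F _ = r₀₁
  go 0F 2F _ = r₀₂
  go 1F 0F _ = R-sym r₀₁
  go 1F 1F 1≢1 = contradiction refl 1≢1
  go 1F 2F _ = r₁₂
  go 2F 0F _ = R-sym r₀₂
  go 2F 1F _ = R-sym r₁₂
  go 2F 2F 2≢2 = contradiction refl 2≢2

-- Cardinality bounds from lists of vertices.

∣p∪q∣≤∣p∣+∣q∣ : ∀ {n} (p q : Subset n) → ∣ p ∪ q ∣ ≤ ∣ p ∣ + ∣ q ∣
∣p∪q∣≤∣p∣+∣q∣ [] [] = z≤n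
∣p∪q∣≤∣p∣+∣q∣ (outside ∷ p) (outside ∷ q) = ∣p∪q∣≤∣p∣+∣q∣ p q
∣p∪q∣≤∣p∣+∣q∣ (outside ∷ p) (inside ∷ q) =
  subst (suc ∣ p ∪ q ∣ ≤_) (sym (ℕ.+-suc ∣ p ∣ ∣ q ∣)) (s≤s (∣p∪q∣≤∣p∣+∣q∣ p q))
∣p∪q∣≤∣p∣+∣q∣ (inside ∷ p) (outside ∷ q) = s≤s (∣p∪q∣≤∣p∣+∣q∣ p q)
∣p∪q∣≤∣p∣+∣q∣ (inside ∷ p) (inside ∷ q) = s≤s
  (ℕ.≤-trans (∣p∪q∣≤∣p∣+∣q∣ p q) (ℕ.+-monoʳ-≤ ∣ p ∣ (ℕ.n≤1+n ∣ q ∣)))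

module _ {n : ℕ} where

  open DecMembership (Fin._≟_ {n}) using (_∈?_)

  fromList : List (Fin n) → Subset n
  fromList = foldr (λ x p → ⁅ x ⁆ ∪ p) ∅

  ∈-fromList⁺ : ∀ {x xs} → x List.∈ xs → x ∈ fromList xs
  ∈-fromList⁺ (here refl) = Subset.x∈p∪q⁺ (inj₁ (Subset.x∈⁅x⁆ _))
  ∈-fromList⁺ (there x∈xs) = Subset.x∈p∪q⁺ (inj₂ (∈-fromList⁺ x∈xs))

  ∣fromList∣≤length : ∀ xs → ∣ fromList xs ∣ ≤ length xs
  ∣fromList∣≤length [] = ℕ.≤-reflexive (Subset.∣⊥∣≡0 n)
  ∣fromList∣≤length (x ∷ xs) = ℕ.≤-trans (∣p∪q∣≤∣p∣+∣q∣ ⁅ x ⁆ (fromList xs))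
    (ℕ.+-mono-≤ (ℕ.≤-reflexive (Subset.∣⁅x⁆∣≡1 x)) (∣fromList∣≤length xs))

  -- Pigeonhole; it supplies the common neighbours promised by λ and μ, and fresh neighbours of a
  -- vertex.
  length<∣p∣⇒∃∉ : ∀ {p : Subset n} {xs} → length xs < ∣ p ∣ →
    ∃ λ x → x ∈ p × x List.∉ xs
  length<∣p∣⇒∃∉ {p} {xs} lt
    with Fin.any? (λ x → (x Subset.∈? p) ×-dec ¬? (x ∈? xs))
  ... | yes found = found
  ... | no none = contradiction
    (ℕ.≤-trans (Subset.p⊆q⇒∣p∣≤∣q∣ p⊆xs) (∣fromList∣≤length xs)) (ℕ.<⇒≱ lt)
    where
    p⊆xs : ∀ {x} → x ∈ p → x ∈ fromList xs
    p⊆xs {x} x∈p with x ∈? xs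
    ... | yes x∈xs = ∈-fromList⁺ x∈xs
    ... | no x∉xs = contradiction (x , x∈p , x∉xs) none

  Unique⇒length≤∣p∣ : ∀ {p : Subset n} {xs} → Unique xs → All (_∈ p) xs →
    length xs ≤ ∣ p ∣
  Unique⇒length≤∣p∣ [] [] = z≤n
  Unique⇒length≤∣p∣ (x≢xs ∷ xs!) (x∈p ∷ xs∈p) = ℕ.≤-trans
    (s≤s (Unique⇒length≤∣p∣ xs! (All.zipWith (λ (x≢y , y∈p) →
      Subset.x∈p∧x≢y⇒x∈p-y y∈p (≢-sym x≢y)) (x≢xs , xs∈p))))
    (Subset.x∈p⇒∣p-x∣<∣p∣ x∈p)

-- Common neighbours when λ = 1 and μ = 2.

module _ {n k : ℕ} (G : Graph (Fin n)) (srg : StronglyRegular n k 1 2 G) where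

  open Graph G renaming (sym to ~-sym; Adj to infix 4 _~_; adj? to _~?_)
  open StronglyRegular srg

  ~⇒≢ : ∀ {u w} → u ~ w → u ≢ w
  ~⇒≢ u~w u≡w = irrefl u≡w u~w

  ∈N⁺ : ∀ {u w} → u ~ w → w ∈ N G u
  ∈N⁺ {u} {w} u~w = lookup⇒[]= w (N G u)
    (trans (lookup∘tabulate (λ x → does (u ~? x)) w) (dec-true (u ~? w) u~w))

  ∈N⁻ : ∀ {u w} → w ∈ N G u → u ~ w
  ∈N⁻ {u} {w} w∈N with u ~? w
    | trans (sym (lookup∘tabulate (λ x → does (u ~? x)) w)) ([]=⇒lookup w∈N)
  ... | yes u~w | _ = u~w

  Common : Fin n → Fin n → Fin n → Set
  Common u w t = u ~ t × w ~ t

  ∈N∩N⁺ : ∀ {u w t} → Common u w t → t ∈ N G u ∩ N G w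
  ∈N∩N⁺ (u~t , w~t) = Subset.x∈p∩q⁺ (∈N⁺ u~t , ∈N⁺ w~t)

  ∈N∩N⁻ : ∀ {u w t} → t ∈ N G u ∩ N G w → Common u w t
  ∈N∩N⁻ {u} {w} t∈ with t∈Nu , t∈Nw ← Subset.x∈p∩q⁻ (N G u) (N G w) t∈ =
    ∈N⁻ t∈Nu , ∈N⁻ t∈Nw

  infix 4 _≁_

  _≁_ : Fin n → Fin n → Set
  u ≁ w = u ≢ w × ¬ u ~ w

  ≁-sym : ∀ {u w} → u ≁ w → w ≁ u
  ≁-sym (u≢w , ¬u~w) = ≢-sym u≢w , λ w~u → ¬u~w (~-sym w~u)

  opaque

    third : ∀ {u w} → u ~ w → ∃ λ t → Common u w t
    third {u} {w} u~w
      with t , t∈ , _ ← length<∣p∣⇒∃∉ {xs = []} (ℕ.≤-reflexive (sym (adjacent u w u~w))) =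
      t , ∈N∩N⁻ t∈

    third-unique : ∀ {u w s t} → u ~ w → Common u w s → Common u w t → s ≡ t
    third-unique {u} {w} {s} {t} u~w cs ct = decidable-stable (s Fin.≟ t) λ s≢t →
      ℕ.1+n≰n (subst (2 ≤_) (adjacent u w u~w)
        (Unique⇒length≤∣p∣ ((s≢t ∷ []) ∷ [] ∷ []) (∈N∩N⁺ cs ∷ ∈N∩N⁺ ct ∷ [])))

    otherCommon : ∀ {u w} → u ≁ w → ∀ s → ∃ λ t → Common u w t × t ≢ s
    otherCommon {u} {w} (u≢w , ¬u~w) s
      with t , t∈ , t∉ ← length<∣p∣⇒∃∉ {xs = s ∷ []}
        (ℕ.≤-reflexive (sym (nonadjacent u w u≢w ¬u~w))) =
      t , ∈N∩N⁻ t∈ , λ t≡s → t∉ (here t≡s)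

    otherCommon-unique : ∀ {u w r s t} → u ≁ w → Common u w r →
      Common u w s → s ≢ r → Common u w t → t ≢ r → s ≡ t
    otherCommon-unique {u} {w} {r} {s} {t} (u≢w , ¬u~w) cr cs s≢r ct t≢r =
      decidable-stable (s Fin.≟ t) λ s≢t →
      ℕ.1+n≰n (subst (3 ≤_) (nonadjacent u w u≢w ¬u~w)
        (Unique⇒length≤∣p∣ ((≢-sym s≢r ∷ ≢-sym t≢r ∷ []) ∷ (s≢t ∷ []) ∷ [] ∷ [])
          (∈N∩N⁺ cr ∷ ∈N∩N⁺ cs ∷ ∈N∩N⁺ ct ∷ [])))

  -- If `c` were adjacent to `x`, both `a` and `x` would complete the edge b c to a triangle. This
  -- moves a non-adjacency along a triangle.
  ≁-third : ∀ {a b c x} → a ~ b → Common a b c → b ~ x → a ≁ x → c ≁ x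
  ≁-third a~b (a~c , b~c) b~x (a≢x , ¬a~x) =
    (λ { refl → ¬a~x a~c }) ,
    (λ c~x → a≢x (third-unique b~c (~-sym a~b , ~-sym a~c) (b~x , c~x)))

  -- Otherwise both `a` and `b` would complete the edge v c to a triangle.
  ≁-opposite : ∀ {a b v c} → a ≁ b → Common a b v → Common a b c → c ≢ v → v ≁ c
  ≁-opposite (a≢b , _) (a~v , b~v) (a~c , b~c) c≢v =
    ≢-sym c≢v ,
    λ v~c → a≢b (third-unique v~c (~-sym a~v , ~-sym a~c) (~-sym b~v , ~-sym b~c))

  opaque

    -- Any neighbour `b` of `v` outside the triangle v a a′ serves: if adjacent to `a`, it would be
    -- the third vertex on the edge v a.
    ∃-≁-neighbour : 2 < k → ∀ v → ∃ λ a → ∃ λ b → v ~ a × v ~ b × a ≁ b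
    ∃-≁-neighbour 2<k v =
      let deg : ∀ {m} → m < k → m < ∣ N G v ∣
          deg = subst (_ <_) (sym (regular v))
          a , a∈ , _ = length<∣p∣⇒∃∉ {xs = []} (deg (ℕ.<-trans (s≤s z≤n) 2<k))
          v~a = ∈N⁻ a∈
          a′ , va′ = third v~a
          b , b∈ , b∉ = length<∣p∣⇒∃∉ {xs = a ∷ a′ ∷ []} (deg 2<k)
          v~b = ∈N⁻ b∈
      in a , b , v~a , v~b
       , (λ a≡b → b∉ (here (sym a≡b)))
       , λ a~b → b∉ (there (here (third-unique v~a (v~b , a~b) va′)))

  isOtherCommonNeighbour : ∀ {v a b x} → a ≁ b → Common a b v →
    Common a b x → x ≢ v → IsOtherCommonNeighbour G v a b x
  isOtherCommonNeighbour a≁b abv abx x≢v = record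
    { common = ∈N∩N⁺ abx
    ; other = x≢v
    ; unique = λ y y∈ y≢v → otherCommon-unique a≁b abv (∈N∩N⁻ y∈) y≢v abx x≢v
    }

  -- The pattern and the 3 × 3 grids that it yields.

  module _ (pattern9 : FollowsPaley9Pattern G) where

    opaque

      -- The pattern for the edges a a′ and b b′ of N(v) carries `paley9-square` over to G: (a′,b)_v
      -- is adjacent to `c`, so it is the third vertex `c′` on the edge b c. Thus opposite sides of
      -- a quadrilateral have adjacent third vertices.
      square : ∀ {v a a′ b c c′} → v ~ a → Common v a a′ → v ~ b → a ≁ b →
        Common a b c → c ≢ v → Common b c c′ → a′ ~ c′
      square {v} {a} {a′} {b} {c} {c′} v~a (v~a′ , a~a′) v~b a≁b (a~c , b~c) c≢v bc-c′
        with b′ , v~b′ , b~b′ ← third v~b =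
        let a′≁b = ≁-third (~-sym v~a) (a~a′ , v~a′) v~b a≁b
            ≁b′ : ∀ {x} → x ≁ b → v ~ x → x ≁ b′
            ≁b′ = λ x≁b v~x →
              ≁-sym (≁-third (~-sym v~b) (b~b′ , v~b′) v~x (≁-sym x≁b))
            a≁b′ = ≁b′ a≁b v~a
            a′≁b′ = ≁b′ a′≁b v~a′
            d , (a′~d , b~d) , d≢v = otherCommon a′≁b v
            x₁₄ , ab′x , x₁₄≢v = otherCommon a≁b′ v
            x₂₄ , a′b′x , x₂₄≢v = otherCommon a′≁b′ v
            φ , φ-adj = pattern9 v a a′ b b′
              (∈N⁺ v~a , ∈N⁺ v~a′ , a~a′) (∈N⁺ v~b , ∈N⁺ v~b′ , b~b′)
              (λ eq → b∉ a≁b a′≁b (subst (b ∈_) (sym eq) head))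
              c x₁₄ d x₂₄
              (isOtherCommonNeighbour a≁b (~-sym v~a , ~-sym v~b) (a~c , b~c) c≢v)
              (isOtherCommonNeighbour a≁b′ (~-sym v~a , ~-sym v~b′) ab′x x₁₄≢v)
              (isOtherCommonNeighbour a′≁b (~-sym v~a′ , ~-sym v~b) (a′~d , b~d) d≢v)
              (isOtherCommonNeighbour a′≁b′ (~-sym v~a′ , ~-sym v~b′) a′b′x x₂₄≢v)
            P = Inverse.to φ
            P~ = λ {p} {q} → Equivalence.to (φ-adj p q)
            P~⁻ = λ {p} {q} → Equivalence.from (φ-adj p q)
            P≢ = λ {p} {q} (p≢q : proj₁ p ≢ proj₁ q) (eq : P p ≡ P q) →
              p≢q (cong proj₁ (Injection.injective (↔⇒↣ φ) eq))
            v₉ = v , head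
            a₉ = a , tail head
            a′₉ = a′ , tail (tail head)
            b₉ = b , tail (tail (tail head))
            c₉ = c , tail (tail (tail (tail (tail head))))
            d₉ = d , tail (tail (tail (tail (tail (tail (tail head))))))
            c~d = P~⁻ {c₉} {d₉} (paley9-square
              (P v₉) (P a₉) (P~ v~a) (P a′₉) (P~ v~a′) (P~ a~a′)
              (P b₉) (P~ v~b) (P≢ (proj₁ a≁b)) (λ adj → proj₂ a≁b (P~⁻ adj))
              (P c₉) (P~ a~c) (P~ b~c) (P≢ c≢v)
              (P d₉) (P~ a′~d) (P~ b~d) (P≢ d≢v))
        in subst (a′ ~_) (third-unique b~c (b~d , c~d) bc-c′) a′~d
        where
        head : ∀ {x} {p : Subset n} → x ∈ ⁅ x ⁆ ∪ p
        head = Subset.x∈p∪q⁺ (inj₁ (Subset.x∈⁅x⁆ _))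
        tail : ∀ {x y} {p : Subset n} → x ∈ p → x ∈ ⁅ y ⁆ ∪ p
        tail x∈p = Subset.x∈p∪q⁺ (inj₂ x∈p)
        b∉ : a ≁ b → a′ ≁ b → ¬ b ∈ ⁅ a ⁆ ∪ ⁅ a′ ⁆
        b∉ a≁b a′≁b b∈ with Subset.x∈p∪q⁻ ⁅ a ⁆ ⁅ a′ ⁆ b∈
        ... | inj₁ b∈a = proj₁ a≁b (sym (Subset.x∈⁅y⁆⇒x≡y a b∈a))
        ... | inj₂ b∈a′ = proj₁ a′≁b (sym (Subset.x∈⁅y⁆⇒x≡y a′ b∈a′))

    -- The 3 × 3 rook's graph, which is Paley(9). Only one pair is recorded as non-adjacent;
    -- `diagonal` recovers the others.
    record Grid : Set where
      field
        point    : Fin 3 → Fin 3 → Fin n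
        column   : ∀ {i i′ j} → i ≢ i′ → point i j ~ point i′ j
        row      : ∀ {i j j′} → j ≢ j′ → point i j ~ point i j′
        opposite : point 0F 0F ≁ point 1F 1F

      columnThird : ∀ {i i′ i″ j} → i″ ≢ i → i″ ≢ i′ →
        Common (point i j) (point i′ j) (point i″ j)
      columnThird i″≢i i″≢i′ = column (≢-sym i″≢i) , column (≢-sym i″≢i′)

      rowThird : ∀ {i j j′ j″} → j″ ≢ j → j″ ≢ j′ →
        Common (point i j) (point i j′) (point i j″)
      rowThird j″≢j j″≢j′ = row (≢-sym j″≢j) , row (≢-sym j″≢j′)

      -- `≁-third` moves one end of a non-adjacent pair along its row or column. The inner
      -- `offDiagonal` varies the row indices within columns 0 and 1, the outer one the column
      -- indices.
      diagonal : ∀ {i i′ j j′} → i ≢ i′ → j ≢ j′ → point i j ≁ point i′ j′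
      diagonal i≢i′ j≢j′ =
        offDiagonal (λ j j′ → ∀ {i i′} → i ≢ i′ → point i j ≁ point i′ j′)
          (λ j≢ ≢j ≢j′ d i≢ →
            ≁-third (row j≢) (rowThird ≢j ≢j′) (column i≢) (d i≢))
          (λ j≢ ≢j ≢j′ d i≢ → ≁-sym (≁-third (row (≢-sym j≢))
            (rowThird ≢j′ ≢j) (column (≢-sym i≢)) (≁-sym (d i≢))))
          (offDiagonal (λ i i′ → point i 0F ≁ point i′ 1F)
            (λ i≢ ≢i ≢i′ → ≁-third (column i≢) (columnThird ≢i ≢i′) (row λ ()))
            (λ i≢ ≢i ≢i′ d → ≁-sym (≁-third (column (≢-sym i≢))
              (columnThird ≢i′ ≢i) (row λ ()) (≁-sym d)))
            opposite)
          j≢j′ i≢i′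

    open Grid

    transpose : Grid → Grid
    transpose g = record
      { point = λ i j → point g j i
      ; column = row g
      ; row = column g
      ; opposite = opposite g
      }

    -- The triangles on the four sides of the quadrilateral v a c b give `a′`, `b′`, `d` and `e`;
    -- the ninth point `w` is the third vertex on b′ e. `square` closes the remaining lines.
    spannedGrid : ∀ {v a b c} → v ~ a → v ~ b → a ≁ b → Common a b c → c ≢ v →
      ∃ λ g → point g 0F 0F ≡ v × point g 1F 0F ≡ a ×
              point g 0F 1F ≡ b × point g 1F 1F ≡ c
    spannedGrid {v} {a} {b} {c} v~a v~b a≁b (a~c , b~c) c≢v
      with a′ , v~a′ , a~a′ ← third v~a | b′ , v~b′ , b~b′ ← third v~b
         | d , b~d , c~d ← third b~c | e , a~e , c~e ← third a~c =
      record
        { point = pt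
        ; column = λ {_} {_} {j} → column′ j
        ; row = λ {i} → row′ i
        ; opposite = v≁c
        } , refl , refl , refl , refl
      where
      v≁c = ≁-opposite a≁b (~-sym v~a , ~-sym v~b) (a~c , b~c) c≢v
      a′~d : a′ ~ d
      a′~d = square v~a (v~a′ , a~a′) v~b a≁b (a~c , b~c) c≢v (b~d , c~d)
      b′~e : b′ ~ e
      b′~e = square v~b (v~b′ , b~b′) v~a (≁-sym a≁b) (b~c , a~c) c≢v (a~e , c~e)
      a≁b′ : a ≁ b′
      a≁b′ = ≁-sym (≁-third (~-sym v~b) (b~b′ , v~b′) v~a (≁-sym a≁b))
      a′≁b : a′ ≁ b
      a′≁b = ≁-third (~-sym v~a) (a~a′ , v~a′) v~b a≁b
      a′≁b′ : a′ ≁ b′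
      a′≁b′ = ≁-third (~-sym v~a) (a~a′ , v~a′) v~b′ a≁b′
      e≢v : e ≢ v
      e≢v refl = proj₂ v≁c (~-sym c~e)
      d≢v : d ≢ v
      d≢v refl = proj₂ v≁c (~-sym c~d)
      v≁e = ≁-opposite a≁b′ (~-sym v~a , ~-sym v~b′) (a~e , b′~e) e≢v
      v≁d = ≁-opposite a′≁b (~-sym v~a′ , ~-sym v~b) (a′~d , b~d) d≢v
      w = proj₁ (third b′~e)
      b′~w = proj₁ (proj₂ (third b′~e))
      e~w = proj₂ (proj₂ (third b′~e))
      a′~w : a′ ~ w
      a′~w = square v~a (v~a′ , a~a′) v~b′ a≁b′ (a~e , b′~e) e≢v (b′~w , e~w)
      -- By `square`, the third vertex `w′` on a′ d is also adjacent to `b′`. So `w` and `w′` are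
      -- both the common neighbour of `a′` and `b′` other than `v`.
      d~w : d ~ w
      d~w with w′ , a′~w′ , d~w′ ← third a′~d = subst (d ~_)
        (otherCommon-unique a′≁b′ (~-sym v~a′ , ~-sym v~b′)
          (a′~w′ , square v~b (v~b′ , b~b′) v~a′ (≁-sym a′≁b) (b~d , a′~d) d≢v
            (a′~w′ , d~w′))
          (λ { refl → proj₂ v≁d (~-sym d~w′) })
          (a′~w , b′~w)
          (λ { w≡v → proj₂ v≁e (~-sym (subst (e ~_) w≡v e~w)) }))
        d~w′
      pt : Fin 3 → Fin 3 → Fin n
      pt 0F 0F = v
      pt 0F 1F = b
      pt 0F 2F = b′
      pt 1F 0F = a
      pt 1F 1F = c
      pt 1F 2F = e
      pt 2F 0F = a′
      pt 2F 1F = d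
      pt 2F 2F = w
      column′ : ∀ j {i i′} → i ≢ i′ → pt i j ~ pt i′ j
      column′ 0F = triangle ~-sym (λ i → pt i 0F) v~a v~a′ a~a′
      column′ 1F = triangle ~-sym (λ i → pt i 1F) b~c b~d c~d
      column′ 2F = triangle ~-sym (λ i → pt i 2F) b′~e b′~w e~w
      row′ : ∀ i {j j′} → j ≢ j′ → pt i j ~ pt i j′
      row′ 0F = triangle ~-sym (pt 0F) v~b v~b′ b~b′
      row′ 1F = triangle ~-sym (pt 1F) a~c a~e c~e
      row′ 2F = triangle ~-sym (pt 2F) a′~d a′~w d~w

    -- Vertices off a grid.

    Outside : Grid → Fin n → Set
    Outside g x = ∀ i j → x ≢ point g i j

    opaque

      -- Two neighbours on a line would make `x` the third point of that line. Two neighbours on no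
      -- common line already have two common neighbours in the grid, the other corners of their
      -- rectangle.
      gridNeighbour-unique : ∀ g {x i i′ j j′} → Outside g x →
        x ~ point g i j → x ~ point g i′ j′ → i ≡ i′ × j ≡ j′
      gridNeighbour-unique g {x} {i} {i′} {j} {j′} out x~p x~p′
        with i Fin.≟ i′ | j Fin.≟ j′
      ... | yes i≡i′ | yes j≡j′ = i≡i′ , j≡j′
      ... | yes refl | no j≢j′ with j″ , ≢j , ≢j′ ← thirdIndex j j′ =
        contradiction
          (third-unique (row g j≢j′) (~-sym x~p , ~-sym x~p′) (rowThird g ≢j ≢j′))
          (out i j″)
      ... | no i≢i′ | yes refl with i″ , ≢i , ≢i′ ← thirdIndex i i′ =
        contradiction
          (third-unique (column g i≢i′) (~-sym x~p , ~-sym x~p′) (columnThird g ≢i ≢i′))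
          (out i″ j)
      ... | no i≢i′ | no j≢j′ = contradiction
        (otherCommon-unique (diagonal g i≢i′ j≢j′)
          (row g j≢j′ , column g (≢-sym i≢i′))
          (~-sym x~p , ~-sym x~p′) (out i j′)
          (column g i≢i′ , row g (≢-sym j≢j′))
          (proj₁ (diagonal g (≢-sym i≢i′) j≢j′)))
        (out i′ j)

      outside-neighbour : ∀ g {x y i j} → Outside g x → x ~ point g i j →
        x ~ y → y ≢ point g i j → Outside g y
      outside-neighbour g out x~p x~y y≢p i j refl
        with refl , refl ← gridNeighbour-unique g out x~p x~y = y≢p refl

      -- A point off the grid with no neighbour in it would reach the nine grid
      -- points through 9 · 2 distinct neighbours.
      gridNeighbour : k < 18 → ∀ g {x} → Outside g x → ∃ λ i → ∃ λ j → x ~ point g i j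
      gridNeighbour k<18 g {x} out
        with Fin.any? (λ i → Fin.any? λ j → x ~? point g i j)
      ... | yes found = found
      ... | no none = contradiction
        (subst (18 ≤_) (regular x) (Unique⇒length≤∣p∣
          (Unique.map⁺ via-injective indices!)
          (All.map⁺ (All.universal (λ ijm → ∈N⁺ (proj₁ (proj₂ (via ijm)))) indices))))
        (ℕ.<⇒≱ k<18)
        where
        indices : List (Fin 3 × Fin 3 × Bool)
        indices = cartesianProduct (allFin 3) (cartesianProduct (allFin 3) (false ∷ true ∷ []))
        indices! : Unique indices
        indices! = Unique.cartesianProduct⁺ (Unique.allFin⁺ 3)
          (Unique.cartesianProduct⁺ (Unique.allFin⁺ 3) (((λ ()) ∷ []) ∷ [] ∷ []))
        x≁ : ∀ i j → x ≁ point g i j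
        x≁ i j = out i j , λ x~p → none (i , j , x~p)
        first : ∀ i j → ∃ λ y → Common x (point g i j) y × y ≢ x
        first i j = otherCommon (x≁ i j) x
        second : ∀ i j → ∃ λ y → Common x (point g i j) y × y ≢ proj₁ (first i j)
        second i j = otherCommon (x≁ i j) (proj₁ (first i j))
        via : ((i , j , _) : (Fin 3 × Fin 3 × Bool)) → ∃ λ y → Common x (point g i j) y
        via (i , j , false) = proj₁ (first i j) , proj₁ (proj₂ (first i j))
        via (i , j , true) = proj₁ (second i j) , proj₁ (proj₂ (second i j))
        via-outside : ∀ s → Outside g (proj₁ (via s))
        via-outside s i j y≡p =
          none (i , j , subst (x ~_) y≡p (proj₁ (proj₂ (via s))))
        -- Each intermediate vertex is off the grid, since `x` has no neighbour there; so it is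
        -- adjacent to only one grid point, and different grid points are reached through different
        -- vertices.
        via-injective : ∀ {s t} → proj₁ (via s) ≡ proj₁ (via t) → s ≡ t
        via-injective {s@(_ , _ , m)} {t@(_ , _ , m′)} eq
          with refl , refl ← gridNeighbour-unique g (via-outside s)
            (~-sym (proj₂ (proj₂ (via s))))
            (subst (_~ _) (sym eq) (~-sym (proj₂ (proj₂ (via t)))))
          with m | m′
        ... | false | false = refl
        ... | true | true = refl
        ... | false | true = contradiction (sym eq) (proj₂ (proj₂ (second _ _)))
        ... | true | false = contradiction eq (proj₂ (proj₂ (second _ _)))

    -- Matched grids and the completion of cubes.

    record Parallel (g h : Grid) : Set where
      field
        disjoint   : ∀ i j → Outside g (point h i j)
        leftJoined : ∀ i → point h i 0F ~ point g i 0F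
        topJoined  : ∀ j → point h 0F j ~ point g 0F j

    open Parallel

    opaque

      parallel-transpose : ∀ {g h} → Parallel g h → Parallel (transpose g) (transpose h)
      parallel-transpose p = record
        { disjoint = λ i j i′ j′ → disjoint p j i j′ i′
        ; leftJoined = topJoined p
        ; topJoined = leftJoined p
        }

      gridOutside : ∀ g {y} → y ~ point g 0F 0F → y ≁ point g 1F 0F → y ≁ point g 0F 1F →
        Outside g y
      gridOutside g y~v (_ , ¬y~a) _ 0F 0F refl = irrefl refl y~v
      gridOutside g y~v (_ , ¬y~a) _ 2F 0F refl = ¬y~a (column g λ ())
      gridOutside g y~v (y≢a , _) _ 1F 0F y≡a = y≢a y≡a
      gridOutside g y~v _ (y≢b , _) 0F 1F y≡b = y≢b y≡b
      gridOutside g y~v _ (_ , ¬y~b) 0F 2F refl = ¬y~b (row g λ ())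
      gridOutside g y~v _ _ 1F 1F refl = proj₂ (diagonal g (λ ()) λ ()) y~v
      gridOutside g y~v _ _ 1F 2F refl = proj₂ (diagonal g (λ ()) λ ()) y~v
      gridOutside g y~v _ _ 2F 1F refl = proj₂ (diagonal g (λ ()) λ ()) y~v
      gridOutside g y~v _ _ 2F 2F refl = proj₂ (diagonal g (λ ()) λ ()) y~v

      -- `square` extends the joins at the first two points of column 0, and of row 0, to the third
      -- point.
      parallel : ∀ g h →
        point h 0F 0F ~ point g 0F 0F →
        point h 1F 0F ~ point g 1F 0F →
        point h 0F 1F ~ point g 0F 1F →
        point h 0F 0F ≁ point g 1F 0F →
        point h 0F 0F ≁ point g 0F 1F →
        point h 1F 0F ≁ point g 0F 0F →
        point h 0F 1F ≁ point g 0F 0F →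
        Parallel g h
      parallel g h y~v x~a x′~b y≁a y≁b x≁v x′≁v = record
        { disjoint = disjoint′
        ; leftJoined = left
        ; topJoined = top
        }
        where
        left : ∀ i → point h i 0F ~ point g i 0F
        left 0F = y~v
        left 1F = x~a
        left 2F = square (column h λ ()) (columnThird h (λ ()) λ ()) y~v x≁v
          (x~a , column g λ ()) (≢-sym (proj₁ y≁a)) (columnThird g (λ ()) λ ())
        top : ∀ j → point h 0F j ~ point g 0F j
        top 0F = y~v
        top 1F = x′~b
        top 2F = square (row h λ ()) (rowThird h (λ ()) λ ()) y~v x′≁v
          (x′~b , row g λ ()) (≢-sym (proj₁ y≁b)) (rowThird g (λ ()) λ ())
        y-outside : Outside g (point h 0F 0F)
        y-outside = gridOutside g y~v y≁a y≁b
        left-outside : ∀ i → Outside g (point h i 0F)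
        left-outside 0F = y-outside
        left-outside 1F = outside-neighbour g y-outside y~v (column h λ ()) (proj₁ x≁v)
        left-outside 2F = outside-neighbour g y-outside y~v (column h λ ())
          (proj₁ (≁-third (column h λ ()) (columnThird h (λ ()) λ ()) y~v x≁v))
        top-outside : ∀ j → Outside g (point h 0F j)
        top-outside 0F = y-outside
        top-outside 1F = outside-neighbour g y-outside y~v (row h λ ()) (proj₁ x′≁v)
        top-outside 2F = outside-neighbour g y-outside y~v (row h λ ())
          (proj₁ (≁-third (row h λ ()) (rowThird h (λ ()) λ ()) y~v x′≁v))
        -- If `point h i j` lay in `g`, it would be the one neighbour in `g` of `point h i 0F`,
        -- namely `point g i 0F`. But it is also adjacent to `point h 0F j`, whose one neighbour in
        -- `g` is `point g 0F j`.
        inner-outside : ∀ i j → i ≢ 0F → j ≢ 0F → Outside g (point h i j)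
        inner-outside i j i≢0 j≢0 =
          outside-neighbour g (left-outside i) (left i) (row h (≢-sym j≢0)) λ eq →
            i≢0 (proj₁ (gridNeighbour-unique g (top-outside j)
              (subst (point h 0F j ~_) eq (column h (≢-sym i≢0))) (top j)))
        disjoint′ : ∀ i j → Outside g (point h i j)
        disjoint′ i 0F = left-outside i
        disjoint′ 0F j = top-outside j
        disjoint′ i@(suc _) j@(suc _) = inner-outside i j (λ ()) (λ ())

    module _ (k<18 : k < 18) where

      opaque

        -- Sending a point of h to its unique neighbour in g is injective, and it
        -- maps a row of h into a row of g as soon as it does so for two of its
        -- points.
        parallel-row : ∀ {g h} → Parallel g h → ∀ {a b} →
          point h 1F 1F ~ point g a b → a ≡ 1F
        parallel-row {g} {h} p {a} {b} h₁₁~ with gridNeighbour k<18 g (disjoint p 1F 2F)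
        ... | c , d , h₁₂~ = go a c h₁₁~ h₁₂~
          where
          injective : ∀ {i j i′ j′ a b} → point h i j ~ point g a b →
            point h i′ j′ ~ point g a b → i ≡ i′ × j ≡ j′
          injective ~t ~t′ = gridNeighbour-unique h
            (λ i j eq → disjoint p i j _ _ (sym eq)) (~-sym ~t) (~-sym ~t′)
          row-image : ∀ {i j j′ j″ a b b′} → j ≢ j′ → j″ ≢ j → j″ ≢ j′ →
            point h i j ~ point g a b → point h i j′ ~ point g a b′ →
            ∃ λ b″ → point h i j″ ~ point g a b″
          row-image {i} {j} {j′} {a = a} {b} {b′} j≢j′ j″≢j j″≢j′ u~t u′~t′
            with b Fin.≟ b′
          ... | yes refl = contradiction (proj₂ (injective u~t u′~t′)) j≢j′
          ... | no b≢b′ with b″ , ≢b , ≢b′ ← thirdIndex b b′ =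
            b″ , square (row h j≢j′) (rowThird h j″≢j j″≢j′) u~t
              ( disjoint p i j′ a b
              , λ u′~t → j≢j′ (proj₂ (injective u~t u′~t)) )
              (u′~t′ , row g b≢b′)
              (≢-sym (disjoint p i j a b′))
              (rowThird g ≢b ≢b′)
          unique : ∀ {i j a b a′ b′} → point h i j ~ point g a b →
            point h i j ~ point g a′ b′ → a ≡ a′
          unique ~t ~t′ = proj₁ (gridNeighbour-unique g (disjoint p _ _) ~t ~t′)
          -- Row 0 of `g` is already used up by row 0 of `h`. If (1,1) went to row 2 and (1,2) to
          -- row 1, then (1,0) and (1,2) would force (1,1) into row 1. If both went to row 2, they
          -- would force (1,0) there too, against `leftJoined`.
          go : ∀ a c → point h 1F 1F ~ point g a b → point h 1F 2F ~ point g c d → a ≡ 1F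
          go 0F _ ~t _ = contradiction (proj₁ (injective (topJoined p b) ~t)) λ ()
          go 1F _ _ _ = refl
          go 2F 0F _ ~t′ = contradiction (proj₁ (injective (topJoined p d) ~t′)) λ ()
          go 2F 1F ~t ~t′
            with _ , ~t″ ← row-image {j″ = 1F} (λ ()) (λ ()) (λ ()) (leftJoined p 1F) ~t′ =
            unique ~t ~t″
          go 2F 2F ~t ~t′
            with _ , ~t″ ← row-image {j″ = 0F} (λ ()) (λ ()) (λ ()) ~t ~t′ =
            unique ~t″ (leftJoined p 1F)

        -- `parallel-row` fixes the row of the neighbour, and for the transposed grids its column.
        parallel-joined : ∀ {g h} → Parallel g h → point h 1F 1F ~ point g 1F 1F
        parallel-joined {g} {h} p
          with a , b , h₁₁~ ← gridNeighbour k<18 g (disjoint p 1F 1F)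
          with refl ← parallel-row p h₁₁~
             | refl ← parallel-row (parallel-transpose p) h₁₁~ = h₁₁~

        -- The faces v a c b and y x s x′ span grids that are parallel through the edges y v, x a
        -- and x′ b; the fourth edge between the faces is `parallel-joined`.
        cube : ∀ {v a b c y x x′ s} →
          v ~ a → v ~ b → a ≁ b → Common a b c → c ≢ v →
          y ~ x → y ~ x′ → x ≁ x′ → Common x x′ s → s ≢ y →
          y ~ v → x ~ a → x′ ~ b → y ≁ a → y ≁ b → x ≁ v → x′ ≁ v → s ~ c
        cube v~a v~b a≁b abc c≢v y~x y~x′ x≁x′ xx′s s≢y y~v x~a x′~b y≁a y≁b x≁v x′≁v
          with g , refl , refl , refl , refl ← spannedGrid v~a v~b a≁b abc c≢v
             | h , refl , refl , refl , refl ← spannedGrid y~x y~x′ x≁x′ xx′s s≢y =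
          parallel-joined (parallel g h y~v x~a x′~b y≁a y≁b x≁v x′≁v)

      -- Links between the neighbours of `v` off a grid.

      module _ (g : Grid) where

        v s : Fin n
        v = point g 0F 0F
        s = point g 1F 1F

        OffGrid : Fin n → Set
        OffGrid y = v ~ y × Outside g y

        record Linked (y y′ : Fin n) : Set where
          constructor link
          field
            distinct : y ≢ y′
            {via}    : Fin n
            s~via    : s ~ via
            via~     : via ~ y
            via~′    : via ~ y′

        Linked-sym : ∀ {y y′} → Linked y y′ → Linked y′ y
        Linked-sym (link y≢y′ s~x x~y x~y′) = link (≢-sym y≢y′) s~x x~y′ x~y

        OffGrid⇒≁s : ∀ {y} → OffGrid y → y ≁ s
        OffGrid⇒≁s (v~y , out) = out 1F 1F , λ y~s →
          contradiction (proj₁ (gridNeighbour-unique g out (~-sym v~y) y~s)) λ ()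

        opaque

          -- The one grid neighbour of `y` is `v`, and a via is not `v` because `s` is not adjacent
          -- to `v`.
          via-outside : ∀ {y x} → OffGrid y → s ~ x → x ~ y → Outside g x
          via-outside (v~y , out) s~x x~y = outside-neighbour g out (~-sym v~y) (~-sym x~y)
            λ { refl → proj₂ (opposite g) (~-sym s~x) }

          via≁v : ∀ {y x} → OffGrid y → s ~ x → x ~ y → x ≁ v
          via≁v yo s~x x~y = via-outside yo s~x x~y 0F 0F , λ x~v → contradiction
            (proj₁ (gridNeighbour-unique g (via-outside yo s~x x~y) (~-sym s~x) x~v)) λ ()

          Linked-offGrid : ∀ {y y′} → OffGrid y → v ~ y′ → Linked y y′ → OffGrid y′
          Linked-offGrid yo v~y′ (link _ s~x x~y x~y′) =
            v~y′ , outside-neighbour g (via-outside yo s~x x~y) (~-sym s~x) x~y′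
              λ { refl → proj₂ (opposite g) v~y′ }

          -- The via and `v` have two common neighbours, and `y` is one of them.
          sameVia : ∀ {y x a b} → OffGrid y → s ~ x → x ~ y → v ~ a → v ~ b →
            x ~ a → x ~ b → a ≢ y → b ≢ y → a ≡ b
          sameVia yo s~x x~y v~a v~b x~a x~b a≢y b≢y = otherCommon-unique
            (via≁v yo s~x x~y) (x~y , proj₁ yo) (x~a , v~a) a≢y (x~b , v~b) b≢y

          -- Two links from y with the same via end in the same point, and y has only two
          -- common neighbours with s.
          Linked-atMostTwo : ∀ {y a b w} → OffGrid y → v ~ a → v ~ b → v ~ w → a ≢ b →
            Linked y a → Linked y b → Linked y w → w ≡ a ⊎ w ≡ b
          Linked-atMostTwo {y} {a} {b} {w} yo v~a v~b v~w a≢b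
            (link y≢a {xa} s~xa xa~y xa~a) (link y≢b {xb} s~xb xb~y xb~b)
            (link y≢w {xw} s~xw xw~y xw~w)
            with xw Fin.≟ xa | xw Fin.≟ xb
          ... | yes refl | _ =
            inj₁ (sameVia yo s~xw xw~y v~w v~a xw~w xa~a (≢-sym y≢w) (≢-sym y≢a))
          ... | no _ | yes refl =
            inj₂ (sameVia yo s~xw xw~y v~w v~b xw~w xb~b (≢-sym y≢w) (≢-sym y≢b))
          ... | no xw≢xa | no xw≢xb = contradiction
            (otherCommon-unique (OffGrid⇒≁s yo) (~-sym xa~y , s~xa)
              (~-sym xw~y , s~xw) xw≢xa (~-sym xb~y , s~xb) xb≢xa)
            xw≢xb
            where
            xb≢xa : xb ≢ xa
            xb≢xa refl =
              a≢b (sameVia yo s~xa xa~y v~a v~b xa~a xb~b (≢-sym y≢a) (≢-sym y≢b))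

          -- Let `z` be the common neighbour of `y′` and `y″` other than `v`. The faces v y′ z y″
          -- and y x s x′ form a cube, so `s` is adjacent to `z`, and `z` is a via from `y′` to
          -- `y″`.
          Linked-transitive : ∀ {y x x′ y′ y″} → OffGrid y →
            y ~ x → s ~ x → y ~ x′ → s ~ x′ → x′ ≢ x →
            x ~ y′ → v ~ y′ → y′ ≢ y → x′ ~ y″ → v ~ y″ → y″ ≢ y → Linked y′ y″
          Linked-transitive {y} {x} {x′} {y′} {y″} yo@(v~y , _)
            y~x s~x y~x′ s~x′ x′≢x x~y′ v~y′ y′≢y x′~y″ v~y″ y″≢y =
            link y′≢y″ (cube v~y′ v~y″ y′≁y″ (y′~z , y″~z) z≢v
                  y~x y~x′ x≁x′ (~-sym s~x , ~-sym s~x′) (≢-sym (proj₁ y≁s))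
                  (~-sym v~y) x~y′ x′~y″ y≁y′ y≁y″ x≁v x′≁v)
                (~-sym y′~z) (~-sym y″~z)
            where
            y≁s : y ≁ s
            y≁s = OffGrid⇒≁s yo
            x~y : x ~ y
            x~y = ~-sym y~x
            x′~y : x′ ~ y
            x′~y = ~-sym y~x′
            x≁v : x ≁ v
            x≁v = via≁v yo s~x x~y
            x′≁v : x′ ≁ v
            x′≁v = via≁v yo s~x′ x′~y
            y≁y′ : y ≁ y′
            y≁y′ = ≢-sym y′≢y , λ y~y′ →
              proj₁ x≁v (third-unique y~y′ (y~x , ~-sym x~y′) (~-sym v~y , ~-sym v~y′))
            y≁y″ : y ≁ y″
            y≁y″ = ≢-sym y″≢y , λ y~y″ →
              proj₁ x′≁v (third-unique y~y″ (y~x′ , ~-sym x′~y″) (~-sym v~y , ~-sym v~y″))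
            x≁x′ : x ≁ x′
            x≁x′ = ≢-sym x′≢x , λ x~x′ →
              proj₁ y≁s (third-unique x~x′ (x~y , x′~y) (~-sym s~x , ~-sym s~x′))
            -- Otherwise `v`, `x` and `x′` would be three common neighbours of `y` and `y′`.
            y′≢y″ : y′ ≢ y″
            y′≢y″ refl = x′≢x (otherCommon-unique y≁y′ (~-sym v~y , ~-sym v~y′)
              (y~x′ , ~-sym x′~y″) (proj₁ x′≁v) (y~x , ~-sym x~y′) (proj₁ x≁v))
            -- Otherwise `square` on v y′ x y joins `y″` to the third vertex `t` on y x. Then `t` is
            -- the common neighbour of `y` and `y″` other than `v`, which is `x′`, against `x≁x′`.
            ¬y′~y″ : ¬ y′ ~ y″
            ¬y′~y″ y′~y″ with t , y~t , x~t ← third y~x = proj₂ x≁x′ (subst (x ~_)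
              (otherCommon-unique y≁y″ (~-sym v~y , ~-sym v~y″)
                ( y~t
                , square v~y′ (v~y″ , y′~y″) v~y (≁-sym y≁y′) (~-sym x~y′ , y~x)
                    (proj₁ x≁v) (y~t , x~t) )
                (λ { refl → proj₂ x≁v x~t })
                (y~x′ , ~-sym x′~y″) (proj₁ x′≁v))
              x~t)
            y′≁y″ : y′ ≁ y″
            y′≁y″ = y′≢y″ , ¬y′~y″
            z : Fin n
            z = proj₁ (otherCommon y′≁y″ v)
            y′~z : y′ ~ z
            y′~z = proj₁ (proj₁ (proj₂ (otherCommon y′≁y″ v)))
            y″~z : y″ ~ z
            y″~z = proj₂ (proj₁ (proj₂ (otherCommon y′≁y″ v)))
            z≢v : z ≢ v
            z≢v = proj₂ (proj₂ (otherCommon y′≁y″ v))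

          linkedTriple : ∀ {y} → OffGrid y → ∃ λ y′ → ∃ λ y″ →
            v ~ y′ × v ~ y″ × Linked y y′ × Linked y y″ × Linked y′ y″
          linkedTriple {y} yo
            -- `v` is a default here: it is not adjacent to `s`, so avoiding it excludes no common
            -- neighbour. The second via is found by avoiding `x`.
            with x , (y~x , s~x) , _ ← otherCommon (OffGrid⇒≁s yo) v
            with x′ , (y~x′ , s~x′) , x′≢x ← otherCommon (OffGrid⇒≁s yo) x
            with y′ , (x~y′ , v~y′) , y′≢y ← otherCommon (via≁v yo s~x (~-sym y~x)) y
            with y″ , (x′~y″ , v~y″) , y″≢y ← otherCommon (via≁v yo s~x′ (~-sym y~x′)) y =
            y′ , y″ , v~y′ , v~y″ , link (≢-sym y′≢y) s~x (~-sym y~x) x~y′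
              , link (≢-sym y″≢y) s~x′ (~-sym y~x′) x′~y″
              , Linked-transitive yo y~x s~x y~x′ s~x′ x′≢x x~y′ v~y′ y′≢y x′~y″ v~y″ y″≢y

        -- Counting the neighbours of `v` by classes of three.

        -- Containing the grid neighbours of `v` ensures that any neighbour missing from the list is
        -- off the grid; closure under links keeps a new class disjoint from the list.
        record LinkClosed (ys : List (Fin n)) : Set where
          field
            unique     : Unique ys
            neighbours : All (v ~_) ys
            grid⊆      : ∀ {i j} → v ~ point g i j → point g i j List.∈ ys
            closed     : ∀ {y y′} → y List.∈ ys → OffGrid y → v ~ y′ → Linked y y′ →
                         y′ List.∈ ys

        open LinkClosed

        opaque

          -- A missing neighbour of `v` brings in its whole class. Each member is linked to the
          -- other two, so by `Linked-atMostTwo` no link leaves the class.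
          extend : ∀ {ys} → LinkClosed ys → length ys < k →
            ∃ λ ys′ → LinkClosed ys′ × length ys′ ≡ 3 + length ys
          extend {ys} c ys<k
            with y , y∈N , y∉ ← length<∣p∣⇒∃∉ {xs = ys} (subst (_ <_) (sym (regular v)) ys<k)
            with yo ← (λ (v~y : v ~ y) → v~y , λ { i j refl → y∉ (grid⊆ c v~y) }) (∈N⁻ y∈N)
            with y′ , y″ , v~y′ , v~y″ , yy′ , yy″ , y′y″ ← linkedTriple yo =
            y ∷ y′ ∷ y″ ∷ ys , record
              { unique = (Linked.distinct yy′ ∷ Linked.distinct yy″ ∷ All.¬Any⇒All¬ ys y∉)
                       ∷ (Linked.distinct y′y″ ∷ All.¬Any⇒All¬ ys (∉ys yo′ yy′))
                       ∷ All.¬Any⇒All¬ ys (∉ys yo″ yy″)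
                       ∷ unique c
              ; neighbours = proj₁ yo ∷ v~y′ ∷ v~y″ ∷ neighbours c
              ; grid⊆ = λ v~p → there (there (there (grid⊆ c v~p)))
              ; closed = closed′
              } , refl
            where
            yo′ : OffGrid y′
            yo′ = Linked-offGrid yo v~y′ yy′
            yo″ : OffGrid y″
            yo″ = Linked-offGrid yo v~y″ yy″
            ∉ys : ∀ {w} → OffGrid w → Linked y w → w List.∉ ys
            ∉ys wo yw w∈ = y∉ (closed c w∈ wo (proj₁ yo) (Linked-sym yw))
            closed′ : ∀ {u w} → u List.∈ y ∷ y′ ∷ y″ ∷ ys → OffGrid u → v ~ w →
              Linked u w → w List.∈ y ∷ y′ ∷ y″ ∷ ys
            closed′ (here refl) uo v~w uw
              with Linked-atMostTwo uo v~y′ v~y″ v~w (Linked.distinct y′y″) yy′ yy″ uw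
            ... | inj₁ refl = there (here refl)
            ... | inj₂ refl = there (there (here refl))
            closed′ (there (here refl)) uo v~w uw
              with Linked-atMostTwo uo (proj₁ yo) v~y″ v~w (Linked.distinct yy″)
                (Linked-sym yy′) y′y″ uw
            ... | inj₁ refl = here refl
            ... | inj₂ refl = there (there (here refl))
            closed′ (there (there (here refl))) uo v~w uw
              with Linked-atMostTwo uo (proj₁ yo) v~y′ v~w (Linked.distinct yy′)
                (Linked-sym yy″) (Linked-sym y′y″) uw
            ... | inj₁ refl = here refl
            ... | inj₂ refl = there (here refl)
            closed′ (there (there (there u∈))) uo v~w uw =
              there (there (there (closed c u∈ uo v~w uw)))

        gridLinkClosed : LinkClosed
          (point g 1F 0F ∷ point g 2F 0F ∷ point g 0F 1F ∷ point g 0F 2F ∷ [])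
        gridLinkClosed = record
          { unique = (~⇒≢ (column g λ ()) ∷ proj₁ (diagonal g (λ ()) λ ())
                        ∷ proj₁ (diagonal g (λ ()) λ ()) ∷ [])
                   ∷ (proj₁ (diagonal g (λ ()) λ ()) ∷ proj₁ (diagonal g (λ ()) λ ()) ∷ [])
                   ∷ (~⇒≢ (row g λ ()) ∷ []) ∷ [] ∷ []
          ; neighbours = column g (λ ()) ∷ column g (λ ()) ∷ row g (λ ()) ∷ row g (λ ()) ∷ []
          ; grid⊆ = λ {i} {j} → grid∈ i j
          ; closed = λ
              { (here refl) (_ , out) → contradiction refl (out 1F 0F)
              ; (there (here refl)) (_ , out) → contradiction refl (out 2F 0F)
              ; (there (there (here refl))) (_ , out) → contradiction refl (out 0F 1F)
              ; (there (there (there (here refl)))) (_ , out) → contradiction refl (out 0F 2F)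
              }
          }
          where
          grid∈ : ∀ i j → v ~ point g i j → point g i j List.∈ _
          grid∈ 0F 0F v~v = contradiction v~v (irrefl refl)
          grid∈ 1F 0F _ = here refl
          grid∈ 2F 0F _ = there (here refl)
          grid∈ 0F 1F _ = there (there (here refl))
          grid∈ 0F 2F _ = there (there (there (here refl)))
          grid∈ (suc i) (suc j) v~p = contradiction v~p (proj₂ (diagonal g (λ ()) λ ()))

        opaque

          -- At `suc m` the hypothesis reads 4 + 3m < k: the list built so far, of length 4 + 3m,
          -- still misses a neighbour of `v`.
          ∃-LinkClosed : ∀ m → 1 + m * 3 < k →
            ∃ λ ys → LinkClosed ys × length ys ≡ 4 + m * 3
          ∃-LinkClosed 0 _ = _ , gridLinkClosed , refl
          ∃-LinkClosed (suc m) lt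
            with ys , c , len ← ∃-LinkClosed m (ℕ.<-trans (ℕ.m≤n+m _ 2) lt)
            with ys′ , c′ , len′ ← extend c (subst (_< k) (sym len) lt) =
            ys′ , c′ , trans len′ (cong (3 +_) len)

        LinkClosed⇒length≤k : ∀ {ys} → LinkClosed ys → length ys ≤ k
        LinkClosed⇒length≤k c = subst (_ ≤_) (regular v)
          (Unique⇒length≤∣p∣ (unique c) (All.map ∈N⁺ (neighbours c)))

-- The contradiction in degree 14.

theorem3p4p2 : (G : Graph (Fin 99)) → Connected G →
    StronglyRegular 99 14 1 2 G → ¬ FollowsPaley9Pattern G
theorem3p4p2 G _ srg pattern9
  with a , b , v~a , v~b , a≁b ← ∃-≁-neighbour G srg (ℕ.m≤m+n 3 11) 0F
  with c , abc , c≢v ← otherCommon G srg a≁b 0F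
  with g , _ ← spannedGrid G srg pattern9 v~a v~b a≁b abc c≢v
  -- Three classes and the four grid neighbours make 13 < 14 vertices, so one neighbour of `v` is
  -- left; its class, the fourth, raises the count to 16 > 14.
  with ys , closed , length≡16 ← ∃-LinkClosed G srg pattern9 (ℕ.m≤m+n 15 3) g 4 ℕ.≤-refl =
  ℕ.<⇒≱ (ℕ.m≤m+n 15 1) (subst (_≤ 14) length≡16
    (LinkClosed⇒length≤k G srg pattern9 (ℕ.m≤m+n 15 3) g closed))
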